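{- Let $H$ be a bipartite graph on at most $h$ vertices containing at least one cycle. Then for all sufficiently large $n$, $\mathrm{nim}_2(n;H)\le\mathrm{ex}(n,H)+h^2$.
   Context: For a 2-edge-colouring of $K_n$, an edge is a NIM-edge if it is not contained in any copy of $H$ all of whose edges have the same colour; $\mathrm{nim}_2(n;H)$ is the maximum number of NIM-edges over all 2-edge-colourings of $K_n$. $\mathrm{ex}(n,H)$ is the maximum number of edges of an $H$-free graph on $n$ vertices. -}

module Defs where

open import Data.Nat using (ℕ; zero; suc; _+_; _≤_; _<ᵇ_)
open import Data.Fin using (Fin; toℕ; inject₁; fromℕ) renaming (zero to fzero; suc to fsuc)
open import Data.Bool using (Bool; true; false; if_then_else_; _∧_)
open import Data.List using (List; map; allFin)
open import Data.Nat.ListAction using (sum)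
open import Data.Product using (Σ; _×_; ∃; ∃-syntax)
open import Relation.Binary.PropositionalEquality using (_≡_; _≢_)
open import Relation.Nullary using (¬_)
open import Function.Definitions using (Injective)

record Graph (k : ℕ) : Set where
  field
    Adj    : Fin k → Fin k → Bool
    sym    : ∀ i j → Adj i j ≡ Adj j i
    irrefl : ∀ i → Adj i i ≡ false
open Graph public

edgeCount : ∀ {k} → Graph k → ℕ
edgeCount {k} G =
  sum (map (λ i → sum (map (λ j → if (toℕ i <ᵇ toℕ j) ∧ Adj G i j then 1 else 0)
                           (allFin k)))
           (allFin k))

IsCopy : ∀ {k n} → Graph k → Graph n → (Fin k → Fin n) → Set
IsCopy H G f = Injective _≡_ _≡_ f × (∀ i j → Adj H i j ≡ true → Adj G (f i) (f j) ≡ true)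

Free : ∀ {k n} → Graph k → Graph n → Set
Free H G = ¬ (Σ _ λ f → IsCopy H G f)

IsEx : ∀ {k} → ℕ → Graph k → ℕ → Set
IsEx n H e =
  (Σ (Graph n) λ G → Free H G × edgeCount G ≡ e) ×
  (∀ (G : Graph n) → Free H G → edgeCount G ≤ e)

Bipartite : ∀ {k} → Graph k → Set
Bipartite {k} H = Σ (Fin k → Bool) λ χ → ∀ i j → Adj H i j ≡ true → χ i ≢ χ j

HasCycle : ∀ {k} → Graph k → Set
HasCycle {k} H = Σ ℕ λ m → Σ (Fin (3 + m) → Fin k) λ v →
  Injective _≡_ _≡_ v ×
  (∀ (i : Fin (2 + m)) → Adj H (v (inject₁ i)) (v (fsuc i)) ≡ true) ×
  Adj H (v (fromℕ (2 + m))) (v fzero) ≡ true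

-- A 2-edge-colouring of K_n (colour of the edge {u,v}, u ≢ v; diagonal irrelevant).
record Colouring (n : ℕ) : Set where
  field
    col    : Fin n → Fin n → Bool
    colSym : ∀ u v → col u v ≡ col v u
open Colouring public

InMonoCopy : ∀ {k n} → Graph k → Colouring n → Fin n → Fin n → Set
InMonoCopy {k} {n} H c u v =
  Σ Bool λ b → Σ (Fin k → Fin n) λ f →
    Injective _≡_ _≡_ f ×
    (∀ i j → Adj H i j ≡ true → col c (f i) (f j) ≡ b) ×
    (∃[ i ] ∃[ j ] (Adj H i j ≡ true × f i ≡ u × f j ≡ v))

IsNIM : ∀ {k n} → Graph k → Colouring n → Fin n → Fin n → Set
IsNIM H c u v = ¬ InMonoCopy H c u v

-- nim₂(n;H) ≤ B : every 2-edge-colouring of K_n has at most B NIM-edges,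
-- i.e. every set S of NIM-edges (given as a graph on Fin n) has ≤ B edges.
NimAtMost : ∀ {k} → ℕ → Graph k → ℕ → Set
NimAtMost n H B =
  ∀ (c : Colouring n) (S : Graph n) →
    (∀ u v → Adj S u v ≡ true → IsNIM H c u v) → edgeCount S ≤ B

{-# OPTIONS --safe #-}
module Submission where

-- Write S_b for the NIM-edges of colour b; each S_b is H-free. If some vertex v has large degree in S_b, then S_¬b has
-- at most k² edges: given k² + 1 of them, Ramsey yields inside the S_b-neighbourhood of v a large monochromatic clique Q
-- to which every endpoint of these edges is homogeneous. Q has colour ¬b, for otherwise v and Q contain a copy of H
-- through a NIM-edge. If the classes of H have p and r vertices, the set X of vertices joined to Q in colour b (it contains v)
-- has fewer than p elements, two vertices joined to Q in colour ¬b span no edge of S_¬b, and a vertex of X has fewer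
-- than r S_¬b-neighbours outside X; so at most (p - 1)(p + r - 2) ≤ k² edges were chosen, a contradiction.
-- Hence |S| ≤ ex(n,H) + k² in this case. Otherwise both S_b have bounded degree, so |S| = O(n), while ex(n,H) is
-- superlinear because H contains a cycle.

open import Defs
open import Data.Nat
open import Data.Nat.Properties
open import Data.Nat.DivMod using (_mod_; _%_; _/_; m≡m%n+[m/n]*n; m%n<n; m<n⇒m%n≡m; %-distribˡ-+; [m+n]%n≡m%n)
open import Data.Nat.Tactic.RingSolver using (solve-∀)
open import Data.Nat.ListAction using (sum)
open import Data.Bool using (Bool; true; false; if_then_else_; _∧_; _∨_; not; T?)
open import Data.Bool.Properties using (T-≡; ¬-not; ∨-zeroʳ; ∨-comm; ∧-comm) renaming (_≟_ to _≟ᵇ_)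
open import Data.Fin using (Fin; toℕ; inject₁; fromℕ; fromℕ<; inject≤) renaming (zero to fzero; suc to fsuc)
open import Data.Fin.Properties using (any?; toℕ-injective; toℕ<n; toℕ-fromℕ<; toℕ-inject₁; toℕ-fromℕ; injective⇒≤; inject≤-injective) renaming (_≟_ to _≟ᶠ_)
open import Data.List using (List; []; _∷_; _++_; map; length; lookup; filter; filterᵇ; concatMap; allFin; cartesianProduct; take; deduplicate)
open import Data.List.Properties using (length-++; length-map; length-tabulate; length-take; filter-++; filter-none)
import Data.List.Membership.DecPropositional as DecMembership
open import Data.List.Membership.Propositional using (_∈_; _∉_; find; lose)
open import Data.List.Membership.Propositional.Properties using (∈-filter⁺; ∈-filter⁻; ∈-map⁺; ∈-map⁻; ∈-allFin; ∈-++⁺ˡ; ∈-++⁺ʳ; ∈-concatMap⁺; ∈-concatMap⁻; ∈-lookup; ∈-deduplicate⁺; ∈-deduplicate⁻)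
open import Data.List.Membership.Setoid.Properties using (index-injective)
open import Data.List.Relation.Unary.Any using (here; there; index)
open import Data.List.Relation.Unary.All as All using ([]; _∷_)
import Data.List.Relation.Unary.All.Properties as All
open import Data.List.Relation.Unary.AllPairs as AllPairs using (AllPairs; []; _∷_)
import Data.List.Relation.Unary.AllPairs.Properties as AllPairs
open import Data.List.Relation.Unary.Unique.Propositional using (Unique)
import Data.List.Relation.Unary.Unique.Propositional.Properties as Unique
open import Data.List.Relation.Unary.Unique.DecPropositional.Properties using (deduplicate-!)
open import Data.List.Relation.Binary.Subset.Propositional using (_⊆_)
open import Data.Product using (Σ; _×_; _,_; proj₁; proj₂)
open import Data.Sum using (_⊎_; inj₁; inj₂; [_,_]′)
open import Data.Empty using (⊥; ⊥-elim)
open import Function using (_∘_; id)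
open import Function.Bundles using (Equivalence)
open import Function.Definitions using (Injective)
open import Relation.Nullary using (¬_; Dec; yes; no; does; contradiction; ¬?; _×-dec_)
open import Relation.Nullary.Decidable using (dec-true)
open import Relation.Binary.Definitions using (tri<; tri≈; tri>; Tri)
open import Relation.Unary using (Decidable)
open import Relation.Binary.PropositionalEquality using (_≡_; _≢_; refl; trans; cong; cong₂; subst; subst₂; setoid; module ≡-Reasoning) renaming (sym to ≡-sym)

-- Lists without repetition

AllPairs-lookup : ∀ {A : Set} {R : A → A → Set} {xs : List A} → (∀ {x y} → R x y → R y x) →
  AllPairs R xs → ∀ i j → i ≢ j → R (lookup xs i) (lookup xs j)
AllPairs-lookup Rsym (x ∷ _) fzero fzero i≢j = contradiction refl i≢j
AllPairs-lookup Rsym (x ∷ _) fzero (fsuc j) _ = All.lookup x (∈-lookup j)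
AllPairs-lookup Rsym (x ∷ _) (fsuc i) fzero _ = Rsym (All.lookup x (∈-lookup i))
AllPairs-lookup Rsym (_ ∷ xs) (fsuc i) (fsuc j) i≢j = AllPairs-lookup Rsym xs i j (i≢j ∘ cong fsuc)

Unique⇒lookup-injective : ∀ {A : Set} {xs : List A} → Unique xs → ∀ {i j} → lookup xs i ≡ lookup xs j → i ≡ j
Unique⇒lookup-injective uniq {i} {j} eq with i ≟ᶠ j
... | yes i≡j = i≡j
... | no i≢j = contradiction eq (AllPairs-lookup (_∘ ≡-sym) uniq i j i≢j)

-- Sending each position of `xs` to a position of the same entry in `ys` is injective, because `xs`
-- has no repetition.
Unique-⊆-length : ∀ {A : Set} {xs ys : List A} → Unique xs → xs ⊆ ys → length xs ≤ length ys
Unique-⊆-length {A} {xs} uniq xs⊆ys = injective⇒≤ {f = λ i → index (xs⊆ys (∈-lookup i))}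
  (λ eq → Unique⇒lookup-injective uniq (index-injective (setoid A) (xs⊆ys (∈-lookup _)) (xs⊆ys (∈-lookup _)) eq))

length-filter-split : ∀ {A : Set} {P : A → Set} (P? : Decidable P) (xs : List A) →
  length (filter P? xs) + length (filter (¬? ∘ P?) xs) ≡ length xs
length-filter-split P? [] = refl
length-filter-split P? (x ∷ xs) with does (P? x)
... | true  = cong suc (length-filter-split P? xs)
... | false = trans (+-suc _ _) (cong suc (length-filter-split P? xs))

length-allFin : ∀ n → length (allFin n) ≡ n
length-allFin n = length-tabulate id

Unique-length≤n : ∀ {n} {xs : List (Fin n)} → Unique xs → length xs ≤ n
Unique-length≤n {n} uniq = ≤-trans (Unique-⊆-length uniq (λ {x} _ → ∈-allFin x)) (≤-reflexive (length-allFin n))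

-- Pigeonhole for choosing a fresh vertex: `ys` holds the forbidden ones and may contain
-- repetitions, as only its length counts.
∃-∉ : ∀ {n} {xs ys : List (Fin n)} → Unique xs → length ys < length xs → Σ (Fin n) λ x → x ∈ xs × x ∉ ys
∃-∉ {n} {xs} {ys} uniq ys<xs with All.all? (λ x → DecMembership._∈?_ _≟ᶠ_ x ys) xs
... | yes xs⊆ys = contradiction (Unique-⊆-length uniq (All.lookup xs⊆ys)) (<⇒≱ ys<xs)
... | no xs⊈ys with find (All.¬All⇒Any¬ (λ x → DecMembership._∈?_ _≟ᶠ_ x ys) xs xs⊈ys)
... | x , x∈xs , x∉ys = x , x∈xs , x∉ys

length-concatMap-≤ : ∀ {A B : Set} (f : A → List B) {d} → (∀ x → length (f x) ≤ d) → ∀ xs →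
  length (concatMap f xs) ≤ length xs * d
length-concatMap-≤ f f≤d [] = z≤n
length-concatMap-≤ f f≤d (x ∷ xs) = ≤-trans (≤-reflexive (length-++ (f x))) (+-mono-≤ (f≤d x) (length-concatMap-≤ f f≤d xs))

-- Sums over lists

indicator : Bool → ℕ
indicator b = if b then 1 else 0

sum-map-mono : ∀ {A : Set} {f g : A → ℕ} → (∀ x → f x ≤ g x) → ∀ xs → sum (map f xs) ≤ sum (map g xs)
sum-map-mono f≤g [] = z≤n
sum-map-mono f≤g (x ∷ xs) = +-mono-≤ (f≤g x) (sum-map-mono f≤g xs)

sum-map-mono-< : ∀ {A : Set} {f g : A → ℕ} → (∀ x → f x ≤ g x) → ∀ {x xs} → x ∈ xs → f x < g x →
  sum (map f xs) < sum (map g xs)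
sum-map-mono-< f≤g {xs = _ ∷ xs} (here refl) fx<gx = +-mono-<-≤ fx<gx (sum-map-mono f≤g xs)
sum-map-mono-< f≤g (there x∈xs) fx<gx = +-mono-≤-< (f≤g _) (sum-map-mono-< f≤g x∈xs fx<gx)

sum-map-+ : ∀ {A : Set} (f g : A → ℕ) xs → sum (map (λ x → f x + g x) xs) ≡ sum (map f xs) + sum (map g xs)
sum-map-+ f g [] = refl
sum-map-+ f g (x ∷ xs) rewrite sum-map-+ f g xs =
  interchange (f x) (g x) (sum (map f xs)) (sum (map g xs))
  where
  interchange : ∀ a b c d → (a + b) + (c + d) ≡ (a + c) + (b + d)
  interchange = solve-∀

sum-map-const : ∀ {A : Set} c (xs : List A) → sum (map (λ _ → c) xs) ≡ length xs * c
sum-map-const c [] = refl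
sum-map-const c (x ∷ xs) = cong (c +_) (sum-map-const c xs)

sum-map-swap : ∀ {A B : Set} (f : A → B → ℕ) xs ys →
  sum (map (λ x → sum (map (f x) ys)) xs) ≡ sum (map (λ y → sum (map (λ x → f x y) xs)) ys)
sum-map-swap f [] ys = ≡-sym (trans (sum-map-const 0 ys) (*-zeroʳ (length ys)))
sum-map-swap f (x ∷ xs) ys = trans (cong (sum (map (f x) ys) +_) (sum-map-swap f xs ys))
  (≡-sym (sum-map-+ (f x) (λ y → sum (map (λ x → f x y) xs)) ys))

length-filterᵇ : ∀ {A : Set} (p : A → Bool) xs → length (filterᵇ p xs) ≡ sum (map (indicator ∘ p) xs)
length-filterᵇ p [] = refl
length-filterᵇ p (x ∷ xs) with p x
... | true  = cong suc (length-filterᵇ p xs)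
... | false = length-filterᵇ p xs

-- Links the list `edges` to the double sum in `edgeCount`, so that single edges can be picked,
-- reoriented and grouped.
length-filterᵇ-cartesianProduct : ∀ {A B : Set} (p : A × B → Bool) xs ys →
  length (filterᵇ p (cartesianProduct xs ys)) ≡ sum (map (λ x → sum (map (λ y → indicator (p (x , y))) ys)) xs)
length-filterᵇ-cartesianProduct p [] ys = refl
length-filterᵇ-cartesianProduct p (x ∷ xs) ys = begin
  length (filterᵇ p (map (x ,_) ys ++ cartesianProduct xs ys))
    ≡⟨ cong length (filter-++ (T? ∘ p) (map (x ,_) ys) (cartesianProduct xs ys)) ⟩
  length (filterᵇ p (map (x ,_) ys) ++ filterᵇ p (cartesianProduct xs ys))
    ≡⟨ length-++ (filterᵇ p (map (x ,_) ys)) ⟩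
  length (filterᵇ p (map (x ,_) ys)) + length (filterᵇ p (cartesianProduct xs ys))
    ≡⟨ cong₂ _+_ (row ys) (length-filterᵇ-cartesianProduct p xs ys) ⟩
  sum (map (λ x → sum (map (λ y → indicator (p (x , y))) ys)) (x ∷ xs)) ∎
  where
  open ≡-Reasoning
  row : ∀ ys → length (filterᵇ p (map (x ,_) ys)) ≡ sum (map (λ y → indicator (p (x , y))) ys)
  row [] = refl
  row (y ∷ ys) with p (x , y)
  ... | true  = cong suc (row ys)
  ... | false = row ys

indicator-mono : ∀ {a b} → (a ≡ true → b ≡ true) → indicator a ≤ indicator b
indicator-mono {false} _ = z≤n
indicator-mono {true} a⇒b rewrite a⇒b refl = ≤-refl

∧-trueˡ : ∀ {a b} → a ∧ b ≡ true → a ≡ true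
∧-trueˡ {true} _ = refl

∧-trueʳ : ∀ {a b} → a ∧ b ≡ true → b ≡ true
∧-trueʳ {true} p = p

∧-true : ∀ {a b} → a ≡ true → b ≡ true → a ∧ b ≡ true
∧-true refl p = p

<⇒<ᵇ≡true : ∀ {m n} → m < n → (m <ᵇ n) ≡ true
<⇒<ᵇ≡true m<n = Equivalence.to T-≡ (<⇒<ᵇ m<n)

-- Degrees and edge counts

nbrs : ∀ {n} → Graph n → Fin n → List (Fin n)
nbrs G x = filterᵇ (Adj G x) (allFin _)

degree : ∀ {n} → Graph n → Fin n → ℕ
degree G x = length (nbrs G x)

∈-nbrs⁺ : ∀ {n} (G : Graph n) {x y} → Adj G x y ≡ true → y ∈ nbrs G x
∈-nbrs⁺ G {x} {y} xy = ∈-filter⁺ (T? ∘ Adj G x) (∈-allFin y) (Equivalence.from T-≡ xy)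

∈-nbrs⁻ : ∀ {n} (G : Graph n) {x y} → y ∈ nbrs G x → Adj G x y ≡ true
∈-nbrs⁻ {n} G {x} y∈ = Equivalence.to T-≡ (proj₂ (∈-filter⁻ (T? ∘ Adj G x) {xs = allFin n} y∈))

nbrs-Unique : ∀ {n} (G : Graph n) x → Unique (nbrs G x)
nbrs-Unique {n} G x = Unique.filter⁺ (T? ∘ Adj G x) (Unique.allFin⁺ n)

Adj⇒≢ : ∀ {n} (G : Graph n) {x y} → Adj G x y ≡ true → x ≢ y
Adj⇒≢ G {x} xy refl with trans (≡-sym xy) (irrefl G x)
... | ()

edges : ∀ {n} → Graph n → List (Fin n × Fin n)
edges {n} G = filterᵇ (λ (i , j) → (toℕ i <ᵇ toℕ j) ∧ Adj G i j) (cartesianProduct (allFin n) (allFin n))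

length-edges : ∀ {n} (G : Graph n) → length (edges G) ≡ edgeCount G
length-edges {n} G = length-filterᵇ-cartesianProduct _ (allFin n) (allFin n)

edges-Unique : ∀ {n} (G : Graph n) → Unique (edges G)
edges-Unique {n} G = Unique.filter⁺ _ (Unique.cartesianProduct⁺ (Unique.allFin⁺ n) (Unique.allFin⁺ n))

∈-edges⁻ : ∀ {n} (G : Graph n) {i j} → (i , j) ∈ edges G → toℕ i < toℕ j × Adj G i j ≡ true
∈-edges⁻ {n} G {i} {j} e∈ = <ᵇ⇒< (toℕ i) (toℕ j) (Equivalence.from T-≡ (∧-trueˡ both)) , ∧-trueʳ {toℕ i <ᵇ toℕ j} both
  where
  both : (toℕ i <ᵇ toℕ j) ∧ Adj G i j ≡ true
  both = Equivalence.to T-≡ (proj₂ (∈-filter⁻ (λ (i , j) → T? ((toℕ i <ᵇ toℕ j) ∧ Adj G i j))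
    {xs = cartesianProduct (allFin n) (allFin n)} e∈))

-- Row `i` counts only the neighbours above `i`, a part of `nbrs G i`; the lost factor two is
-- harmless for a linear bound.
edgeCount-≤-degree : ∀ {n} (G : Graph n) {d} → (∀ x → degree G x ≤ d) → edgeCount G ≤ n * d
edgeCount-≤-degree {n} G {d} deg≤d = begin
  edgeCount G                                 ≤⟨ sum-map-mono row (allFin n) ⟩
  sum (map (λ _ → d) (allFin n))              ≡⟨ sum-map-const d (allFin n) ⟩
  length (allFin n) * d                       ≡⟨ cong (_* d) (length-allFin n) ⟩
  n * d                                       ∎
  where
  open ≤-Reasoning
  row : ∀ i → sum (map (λ j → indicator ((toℕ i <ᵇ toℕ j) ∧ Adj G i j)) (allFin n)) ≤ d
  row i = begin
    sum (map (λ j → indicator ((toℕ i <ᵇ toℕ j) ∧ Adj G i j)) (allFin n))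
      ≤⟨ sum-map-mono (λ j → indicator-mono (∧-trueʳ {toℕ i <ᵇ toℕ j})) (allFin n) ⟩
    sum (map (indicator ∘ Adj G i) (allFin n)) ≡⟨ length-filterᵇ (Adj G i) (allFin n) ⟨
    degree G i                                 ≤⟨ deg≤d i ⟩
    d                                          ∎

-- Each adjacent pair is counted by `up` in one of its two orders; exchanging the summations turns
-- the decreasing pairs into a second copy of `edgeCount G`.
handshake-≤ : ∀ {n} (G : Graph n) → sum (map (degree G) (allFin n)) ≤ edgeCount G + edgeCount G
handshake-≤ {n} G = begin
  sum (map (degree G) V)
    ≤⟨ sum-map-mono (λ x → ≤-reflexive (length-filterᵇ (Adj G x) V)) V ⟩
  sum (map (λ x → sum (map (indicator ∘ Adj G x) V)) V)
    ≤⟨ sum-map-mono (λ x → sum-map-mono (split x) V) V ⟩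
  sum (map (λ x → sum (map (λ y → up x y + up y x) V)) V)
    ≤⟨ sum-map-mono (λ x → ≤-reflexive (sum-map-+ (up x) (λ y → up y x) V)) V ⟩
  sum (map (λ x → sum (map (up x) V) + sum (map (λ y → up y x) V)) V)
    ≡⟨ sum-map-+ (λ x → sum (map (up x) V)) (λ x → sum (map (λ y → up y x) V)) V ⟩
  edgeCount G + sum (map (λ x → sum (map (λ y → up y x) V)) V)
    ≡⟨ cong (edgeCount G +_) (sum-map-swap up V V) ⟨
  edgeCount G + edgeCount G ∎
  where
  open ≤-Reasoning
  V = allFin n
  up : Fin n → Fin n → ℕ
  up i j = indicator ((toℕ i <ᵇ toℕ j) ∧ Adj G i j)
  split : ∀ x y → indicator (Adj G x y) ≤ up x y + up y x
  split x y with Adj G x y in xy | <-cmp (toℕ x) (toℕ y)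
  ... | false | _ = z≤n
  ... | true | tri< x<y _ _ rewrite <⇒<ᵇ≡true x<y = s≤s z≤n
  ... | true | tri≈ _ x≡y _ = contradiction (toℕ-injective x≡y) (Adj⇒≢ G xy)
  ... | true | tri> _ _ y<x rewrite <⇒<ᵇ≡true y<x | trans (sym G y x) xy = m≤n+m 1 _

-- Graphs without a cycle of given length

-- Ends of walks of length exactly `l`, with multiplicity. Using walks instead of paths makes the
-- bound `d ^ l` immediate and still catches every path that could close a cycle.
reach : ∀ {n} → Graph n → ℕ → Fin n → List (Fin n)
reach G zero x = x ∷ []
reach G (suc l) x = concatMap (nbrs G) (reach G l x)

length-reach : ∀ {n} (G : Graph n) {d} → (∀ x → degree G x ≤ d) → ∀ l x → length (reach G l x) ≤ d ^ l
length-reach G deg≤d zero x = ≤-refl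
length-reach G {d} deg≤d (suc l) x = begin
  length (concatMap (nbrs G) (reach G l x)) ≤⟨ length-concatMap-≤ (nbrs G) deg≤d (reach G l x) ⟩
  length (reach G l x) * d                  ≤⟨ *-monoˡ-≤ d (length-reach G deg≤d l x) ⟩
  d ^ l * d                                 ≡⟨ *-comm (d ^ l) d ⟩
  d ^ suc l                                 ∎
  where open ≤-Reasoning

reach-snoc : ∀ {n} (G : Graph n) l {x y z} → y ∈ reach G l x → Adj G y z ≡ true → z ∈ reach G (suc l) x
reach-snoc G l {x} y∈ yz = ∈-concatMap⁺ (nbrs G) (lose y∈ (∈-nbrs⁺ G yz))

-- `reach` lengthens walks at their far end; adding an edge at the start is what allows a walk to be
-- read in reverse.
reach-cons : ∀ {n} (G : Graph n) l {x y z} → Adj G x y ≡ true → z ∈ reach G l y → z ∈ reach G (suc l) x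
reach-cons G zero xy (here refl) = reach-snoc G 0 (here refl) xy
reach-cons G (suc l) {x} {y} xy z∈ with find (∈-concatMap⁻ (nbrs G) {xs = reach G l y} z∈)
... | w , w∈ , z∈w = reach-snoc G (suc l) (reach-cons G l xy w∈) (∈-nbrs⁻ G z∈w)

walk-forward : ∀ {n} (G : Graph n) (g : ℕ → Fin n) l → (∀ t → t < l → Adj G (g t) (g (suc t)) ≡ true) →
  g l ∈ reach G l (g 0)
walk-forward G g zero _ = here refl
walk-forward G g (suc l) adj = reach-snoc G l (walk-forward G g l (λ t t<l → adj t (m<n⇒m<1+n t<l))) (adj l ≤-refl)

-- A cycle can cross an added edge in either direction; the reversed reading lets both cases use
-- `reach` from the same end.
walk-backward : ∀ {n} (G : Graph n) (g : ℕ → Fin n) l → (∀ t → t < l → Adj G (g t) (g (suc t)) ≡ true) →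
  g 0 ∈ reach G l (g l)
walk-backward G g zero _ = here refl
walk-backward G g (suc l) adj = reach-cons G l (trans (sym G (g (suc l)) (g l)) (adj l ≤-refl))
  (walk-backward G g l (λ t t<l → adj t (m<n⇒m<1+n t<l)))

-- An M-cycle is encoded as an M-periodic vertex sequence, so that rotating it is a shift of indices.
record Cycle {n} (M : ℕ) (G : Graph n) : Set where
  field
    vertex    : ℕ → Fin n
    adjacent  : ∀ i → Adj G (vertex i) (vertex (suc i)) ≡ true
    periodic  : ∀ i → vertex (M + i) ≡ vertex i
    injective : ∀ i j → j < M → vertex i ≡ vertex (j + i) → j ≡ 0

-- Adding one edge

module _ {n} (G : Graph n) {u v : Fin n} (u≢v : u ≢ v) where

  addEdge : Graph n
  Adj addEdge i j = Adj G i j ∨ (does (i ≟ᶠ u ×-dec j ≟ᶠ v) ∨ does (i ≟ᶠ v ×-dec j ≟ᶠ u))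
  sym addEdge i j = cong₂ _∨_ (sym G i j) (trans (∨-comm (does (i ≟ᶠ u ×-dec j ≟ᶠ v)) _)
    (cong₂ _∨_ (∧-comm (does (i ≟ᶠ v)) (does (j ≟ᶠ u))) (∧-comm (does (i ≟ᶠ u)) (does (j ≟ᶠ v)))))
  irrefl addEdge i rewrite irrefl G i with i ≟ᶠ u | i ≟ᶠ v
  ... | yes i≡u | yes i≡v = contradiction (trans (≡-sym i≡u) i≡v) u≢v
  ... | yes _   | no _    = refl
  ... | no _    | yes _   = refl
  ... | no _    | no _    = refl

  addEdge-old : ∀ i j → Adj G i j ≡ true → Adj addEdge i j ≡ true
  addEdge-old i j ij rewrite ij = refl

  addEdge-new : Adj addEdge u v ≡ true
  addEdge-new rewrite dec-true (u ≟ᶠ u) refl | dec-true (v ≟ᶠ v) refl = ∨-zeroʳ (Adj G u v)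

  addEdge⁻ : ∀ i j → Adj addEdge i j ≡ true → Adj G i j ≡ true ⊎ ((i ≡ u × j ≡ v) ⊎ (i ≡ v × j ≡ u))
  addEdge⁻ i j = ∨-dec⁻ (i ≟ᶠ u ×-dec j ≟ᶠ v) (i ≟ᶠ v ×-dec j ≟ᶠ u)
    where
    ∨-dec⁻ : ∀ {a} {P Q : Set} (p? : Dec P) (q? : Dec Q) → a ∨ (does p? ∨ does q?) ≡ true → a ≡ true ⊎ (P ⊎ Q)
    ∨-dec⁻ {true}  _       _       _ = inj₁ refl
    ∨-dec⁻ {false} (yes p) _       _ = inj₂ (inj₁ p)
    ∨-dec⁻ {false} (no _)  (yes q) _ = inj₂ (inj₂ q)

  -- Only the two ends gain a neighbour, one each, and their degrees were strictly below `d`.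
  addEdge-degree : ∀ {d} → (∀ x → degree G x ≤ d) → degree G u < d → degree G v < d → ∀ x → degree addEdge x ≤ d
  addEdge-degree {d} deg≤d u<d v<d x = by-cases (x ≟ᶠ u) (x ≟ᶠ v)
    where
    by-cases : Dec (x ≡ u) → Dec (x ≡ v) → degree addEdge x ≤ d
    by-cases (yes refl) _ = ≤-trans (Unique-⊆-length (nbrs-Unique addEdge x) sub) u<d
      where
      sub : nbrs addEdge x ⊆ v ∷ nbrs G x
      sub {y} y∈ with addEdge⁻ x y (∈-nbrs⁻ addEdge y∈)
      ... | inj₁ xy = there (∈-nbrs⁺ G xy)
      ... | inj₂ (inj₁ (_ , y≡v)) = here y≡v
      ... | inj₂ (inj₂ (x≡v , _)) = contradiction x≡v u≢v
    by-cases (no _) (yes refl) = ≤-trans (Unique-⊆-length (nbrs-Unique addEdge x) sub) v<d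
      where
      sub : nbrs addEdge x ⊆ u ∷ nbrs G x
      sub {y} y∈ with addEdge⁻ x y (∈-nbrs⁻ addEdge y∈)
      ... | inj₁ xy = there (∈-nbrs⁺ G xy)
      ... | inj₂ (inj₁ (x≡u , _)) = contradiction (≡-sym x≡u) u≢v
      ... | inj₂ (inj₂ (_ , y≡u)) = here y≡u
    by-cases (no x≢u) (no x≢v) = ≤-trans (Unique-⊆-length (nbrs-Unique addEdge x) sub) (deg≤d x)
      where
      sub : nbrs addEdge x ⊆ nbrs G x
      sub {y} y∈ with addEdge⁻ x y (∈-nbrs⁻ addEdge y∈)
      ... | inj₁ xy = ∈-nbrs⁺ G xy
      ... | inj₂ (inj₁ (x≡u , _)) = contradiction x≡u x≢u
      ... | inj₂ (inj₂ (x≡v , _)) = contradiction x≡v x≢v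

  -- A new cycle passes through uv exactly once; the rest of it is a walk of length 2 + m between u and v.
  addEdge-acyclic : ∀ {m} → ¬ Cycle (3 + m) G → v ∉ reach G (2 + m) u → ¬ Cycle (3 + m) addEdge
  addEdge-acyclic {m} acyclic v∉ C with any? (λ (s : Fin (3 + m)) → Adj G (vertex (toℕ s)) (vertex (suc (toℕ s))) ≟ᵇ false)
    where open Cycle C
  ... | no all-old = acyclic record
    { vertex = vertex ; adjacent = adjacentG ; periodic = periodic ; injective = injective }
    where
    open Cycle C
    multiple : ∀ q i → vertex (q * (3 + m) + i) ≡ vertex i
    multiple zero i = refl
    multiple (suc q) i = trans (cong vertex (+-assoc (3 + m) (q * (3 + m)) i)) (trans (periodic _) (multiple q i))
    reduce : ∀ i → i ≡ i / (3 + m) * (3 + m) + toℕ (i mod (3 + m))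
    reduce i = trans (m≡m%n+[m/n]*n i (3 + m)) (trans (+-comm (i % (3 + m)) _)
      (cong (i / (3 + m) * (3 + m) +_) (≡-sym (toℕ-fromℕ< (m%n<n i (3 + m))))))
    -- Periodicity reduces every index to its remainder `s` below 3 + m, where the search found no
    -- step missing from `G`.
    adjacentG : ∀ i → Adj G (vertex i) (vertex (suc i)) ≡ true
    adjacentG i = subst₂ (λ x y → Adj G x y ≡ true)
      (trans (≡-sym (multiple q s)) (cong vertex (≡-sym (reduce i))))
      (trans (≡-sym (multiple q (suc s))) (cong vertex (trans (+-suc _ s) (cong suc (≡-sym (reduce i))))))
      (¬-not (λ f → all-old (i mod (3 + m) , f)))
      where
      q = i / (3 + m)
      s = toℕ (i mod (3 + m))
  ... | yes (s′ , new) = [ forward , backward ]′ endpoints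
    where
    open Cycle C
    s = toℕ s′
    endpoints : (vertex s ≡ u × vertex (suc s) ≡ v) ⊎ (vertex s ≡ v × vertex (suc s) ≡ u)
    endpoints with addEdge⁻ (vertex s) (vertex (suc s)) (adjacent s)
    ... | inj₂ e = e
    ... | inj₁ old with trans (≡-sym new) old
    ... | ()
    no-repeat : ∀ t → t < 2 + m → vertex (t + suc s) ≡ vertex s → ⊥
    no-repeat t t< eq with injective s (suc t) (s≤s t<) (≡-sym (trans (cong vertex (≡-sym (+-suc t s))) eq))
    ... | ()
    -- The first equality forces t = 0, so the cycle would return to its start after two steps,
    -- which a length of at least three forbids.
    no-reverse : ∀ t → t < 2 + m → vertex (t + suc s) ≡ vertex (suc s) → vertex (suc t + suc s) ≡ vertex s → ⊥
    no-reverse t t< eq eq′ with injective (suc s) t (m<n⇒m<1+n t<) (≡-sym eq)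
    ... | refl = no-repeat 1 (s≤s (s≤s z≤n)) eq′
    -- A second crossing of uv in the same direction would revisit `vertex s`; one in the opposite
    -- direction would turn straight back.
    old-edge : ∀ t → t < 2 + m → Adj G (vertex (t + suc s)) (vertex (suc t + suc s)) ≡ true
    old-edge t t< with addEdge⁻ _ _ (adjacent (t + suc s)) | endpoints
    ... | inj₁ old | _ = old
    ... | inj₂ (inj₁ (a , b)) | inj₁ (a′ , b′) = ⊥-elim (no-repeat t t< (trans a (≡-sym a′)))
    ... | inj₂ (inj₁ (a , b)) | inj₂ (a′ , b′) = ⊥-elim (no-reverse t t< (trans a (≡-sym b′)) (trans b (≡-sym a′)))
    ... | inj₂ (inj₂ (a , b)) | inj₁ (a′ , b′) = ⊥-elim (no-reverse t t< (trans a (≡-sym b′)) (trans b (≡-sym a′)))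
    ... | inj₂ (inj₂ (a , b)) | inj₂ (a′ , b′) = ⊥-elim (no-repeat t t< (trans a (≡-sym a′)))
    last : vertex (2 + m + suc s) ≡ vertex s
    last = trans (cong vertex (+-suc (2 + m) s)) (periodic s)
    forward : vertex s ≡ u × vertex (suc s) ≡ v → ⊥
    forward (a , b) = v∉ (subst₂ (λ x y → x ∈ reach G (2 + m) y) b (trans last a)
      (walk-backward G (λ t → vertex (t + suc s)) (2 + m) old-edge))
    backward : vertex s ≡ v × vertex (suc s) ≡ u → ⊥
    backward (a , b) = v∉ (subst₂ (λ x y → x ∈ reach G (2 + m) y) (trans last a) b
      (walk-forward G (λ t → vertex (t + suc s)) (2 + m) old-edge))

-- Dense graphs without a cycle of fixed length

edgeCount-mono-< : ∀ {n} (G G′ : Graph n) → (∀ i j → Adj G i j ≡ true → Adj G′ i j ≡ true) →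
  ∀ {u v} → Adj G u v ≡ false → Adj G′ u v ≡ true → edgeCount G < edgeCount G′
edgeCount-mono-< {n} G G′ sub {u} {v} uv∉ uv∈ = by-order (<-cmp (toℕ u) (toℕ v))
  where
  entry : ∀ i j → indicator ((toℕ i <ᵇ toℕ j) ∧ Adj G i j) ≤ indicator ((toℕ i <ᵇ toℕ j) ∧ Adj G′ i j)
  entry i j = indicator-mono (λ ij → ∧-true (∧-trueˡ ij) (sub i j (∧-trueʳ {toℕ i <ᵇ toℕ j} ij)))
  ordered : ∀ {u v} → toℕ u < toℕ v → Adj G u v ≡ false → Adj G′ u v ≡ true → edgeCount G < edgeCount G′
  ordered {u} {v} u<v uv∉ uv∈ = sum-map-mono-< (λ i → sum-map-mono (entry i) (allFin n)) (∈-allFin u)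
    (sum-map-mono-< (entry u) (∈-allFin v) strict)
    where
    strict : indicator ((toℕ u <ᵇ toℕ v) ∧ Adj G u v) < indicator ((toℕ u <ᵇ toℕ v) ∧ Adj G′ u v)
    strict rewrite <⇒<ᵇ≡true u<v | uv∉ | uv∈ = ≤-refl
  by-order : Tri (toℕ u < toℕ v) (toℕ u ≡ toℕ v) (toℕ v < toℕ u) → edgeCount G < edgeCount G′
  by-order (tri< u<v _ _) = ordered u<v uv∉ uv∈
  by-order (tri≈ _ u≡v _) = contradiction (toℕ-injective u≡v) (Adj⇒≢ G′ uv∈)
  by-order (tri> _ _ v<u) = ordered v<u (trans (sym G v u) uv∉) (trans (sym G′ v u) uv∈)

low : ∀ {n} → ℕ → Graph n → List (Fin n)
low {n} d G = filter (λ x → degree G x <? d) (allFin n)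

-- Entries outside `P` contribute `d` each through `f`; the others are paid for by the second
-- summand.
length*d≤sum+few : ∀ {A : Set} {P : A → Set} (P? : Decidable P) (f : A → ℕ) {d} → (∀ x → ¬ P x → d ≤ f x) → ∀ xs →
  length xs * d ≤ sum (map f xs) + length (filter P? xs) * d
length*d≤sum+few P? f large [] = z≤n
length*d≤sum+few P? f {d} large (x ∷ xs) with P? x | length*d≤sum+few P? f large xs
... | no ¬p | ih = ≤-trans (+-mono-≤ (large x ¬p) ih) (≤-reflexive (≡-sym (+-assoc (f x) _ _)))
... | yes _ | ih = begin
    d + length xs * d                                     ≤⟨ +-monoʳ-≤ d ih ⟩
    d + (s + l * d)                                       ≤⟨ m≤n+m _ (f x) ⟩
    f x + (d + (s + l * d))                               ≡⟨ rearrange (f x) d s (l * d) ⟩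
    f x + s + (d + l * d)                                 ∎
    where
    open ≤-Reasoning
    s = sum (map f xs)
    l = length (filter P? xs)
    rearrange : ∀ a b c e → a + (b + (c + e)) ≡ a + c + (b + e)
    rearrange = solve-∀

low-or-dense : ∀ {n} (G : Graph n) d → n * d ≤ (edgeCount G + edgeCount G) + length (low d G) * d
low-or-dense {n} G d = begin
  n * d                                                   ≡⟨ cong (_* d) (length-allFin n) ⟨
  length (allFin n) * d                                   ≤⟨ length*d≤sum+few _ (degree G) (λ _ → ≮⇒≥) (allFin n) ⟩
  sum (map (degree G) (allFin n)) + length (low d G) * d  ≤⟨ +-monoˡ-≤ _ (handshake-≤ G) ⟩
  (edgeCount G + edgeCount G) + length (low d G) * d      ∎
  where open ≤-Reasoning

emptyGraph : ∀ n → Graph n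
emptyGraph n = record { Adj = λ _ _ → false ; sym = λ _ _ → refl ; irrefl = λ _ → refl }

-- Greedy construction: as long as more than 1 + d + d ^ (2 + m) vertices have degree < d, two of them
-- can be joined without closing a cycle of length 3 + m.
module _ (m C : ℕ) where

  -- The cap is twice `suc C`: the factor two is lost to the handshake, and the extra one pays for
  -- the low vertices. `lowBound` bounds the number of vertices excluded as partners of a given one.
  maxDegree lowBound : ℕ
  maxDegree = suc C + suc C
  lowBound = 1 + (maxDegree + maxDegree ^ (2 + m))

  Admissible : ∀ {n} → Graph n → Set
  Admissible G = (∀ x → degree G x ≤ maxDegree) × ¬ Cycle (3 + m) G

  extend : ∀ {n} (G : Graph n) → Admissible G → lowBound < length (low maxDegree G) →
    Σ (Graph n) λ G′ → Admissible G′ × edgeCount G < edgeCount G′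
  extend {n} G (deg≤d , acyclic) many = join (∃-∉ {ys = []} low-Unique (≤-trans (s≤s z≤n) many))
    where
    open ≤-Reasoning
    low-Unique : Unique (low maxDegree G)
    low-Unique = Unique.filter⁺ _ (Unique.allFin⁺ n)
    low⁻ : ∀ {x} → x ∈ low maxDegree G → degree G x < maxDegree
    low⁻ x∈ = proj₂ (∈-filter⁻ (λ x → degree G x <? maxDegree) {xs = allFin n} x∈)
    -- The partner of `u` avoids `u` to exclude a loop, its neighbours so that the edge is new, and
    -- the ends of walks of length 2 + m so that no cycle of length 3 + m closes.
    near : Fin n → List (Fin n)
    near u = u ∷ (nbrs G u ++ reach G (2 + m) u)
    near-small : ∀ u → length (near u) < length (low maxDegree G)
    near-small u = begin-strict
      length (near u)                                       ≡⟨ cong suc (length-++ (nbrs G u)) ⟩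
      1 + (degree G u + length (reach G (2 + m) u))         ≤⟨ s≤s (+-mono-≤ (deg≤d u) (length-reach G deg≤d (2 + m) u)) ⟩
      lowBound                                              <⟨ many ⟩
      length (low maxDegree G)                              ∎
    join : (Σ (Fin n) λ u → u ∈ low maxDegree G × u ∉ []) → Σ (Graph n) λ G′ → Admissible G′ × edgeCount G < edgeCount G′
    join (u , u∈ , _) with ∃-∉ low-Unique (near-small u)
    ... | v , v∈ , v∉near = addEdge G u≢v
        , (addEdge-degree G u≢v deg≤d (low⁻ u∈) (low⁻ v∈)
          , addEdge-acyclic G u≢v acyclic (λ v∈r → v∉near (there (∈-++⁺ʳ (nbrs G u) v∈r))))
        , edgeCount-mono-< G (addEdge G u≢v) (addEdge-old G u≢v)
            (¬-not (λ uv → v∉near (there (∈-++⁺ˡ (∈-nbrs⁺ G uv))))) (addEdge-new G u≢v)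
      where
      u≢v : u ≢ v
      u≢v refl = v∉near (here refl)

  -- For such `n` the low vertices cost at most `n + n` in the degree sum, exactly the surplus of
  -- `n * maxDegree` over `n * C * 2`.
  dense : ∀ {n} (G : Graph n) → lowBound * suc C ≤ n → length (low maxDegree G) ≤ lowBound → n * C ≤ edgeCount G
  dense {n} G n-large few = *-cancelʳ-≤ (n * C) (edgeCount G) 2 (+-cancelʳ-≤ (n + n) _ _ (begin
    n * C * 2 + (n + n)                                      ≡⟨ expand n C ⟩
    n * maxDegree                                            ≤⟨ low-or-dense G maxDegree ⟩
    (edgeCount G + edgeCount G) + length (low maxDegree G) * maxDegree
      ≤⟨ +-monoʳ-≤ (edgeCount G + edgeCount G) (*-monoˡ-≤ maxDegree few) ⟩
    (edgeCount G + edgeCount G) + lowBound * maxDegree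
      ≡⟨ cong₂ _+_ (double (edgeCount G)) (*-distribˡ-+ lowBound (suc C) (suc C)) ⟩
    edgeCount G * 2 + (lowBound * suc C + lowBound * suc C)  ≤⟨ +-monoʳ-≤ (edgeCount G * 2) (+-mono-≤ n-large n-large) ⟩
    edgeCount G * 2 + (n + n)                                ∎))
    where
    open ≤-Reasoning
    expand : ∀ n C → n * C * 2 + (n + n) ≡ n * (suc C + suc C)
    expand = solve-∀
    double : ∀ e → e + e ≡ e * 2
    double = solve-∀

  emptyGraph-admissible : ∀ n → Admissible (emptyGraph n)
  emptyGraph-admissible n = (λ x → ≤-trans (≤-reflexive (cong length (filter-none _ (All.universal (λ _ ()) (allFin n))))) z≤n)
    , (λ c → contradiction (Cycle.adjacent c 0) λ ())

  -- Induction on the number `j` of edges to be reached replaces a termination argument: a graph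
  -- with few low vertices already has `n * C` edges, and any other gains one.
  grow : ∀ {n} → lowBound * suc C ≤ n → ∀ j → j ≤ n * C → Σ (Graph n) λ G → Admissible G × j ≤ edgeCount G
  grow {n} n-large zero _ = emptyGraph n , emptyGraph-admissible n , z≤n
  grow {n} n-large (suc j) j<nC = raise (grow n-large j (<⇒≤ j<nC))
    where
    more : ∀ G → j ≤ edgeCount G → (Σ (Graph n) λ G′ → Admissible G′ × edgeCount G < edgeCount G′) →
      Σ (Graph n) λ G → Admissible G × suc j ≤ edgeCount G
    more _ j≤ (G′ , ok , larger) = G′ , ok , ≤-trans (s≤s j≤) larger
    raise : (Σ (Graph n) λ G → Admissible G × j ≤ edgeCount G) → Σ (Graph n) λ G → Admissible G × suc j ≤ edgeCount G
    raise (G , ok , j≤) = [ (λ few → G , ok , ≤-trans j<nC (dense G n-large few)) , more G j≤ ∘ extend G ok ]′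
      (≤-<-connex (length (low maxDegree G)) lowBound)

-- The periodic sequence reads `v` at indices modulo 3 + m; `adj` gives the steps within a period
-- and `closing` the wrap-around.
Cycle-from-Fin : ∀ {n m} (G : Graph n) (v : Fin (3 + m) → Fin n) → Injective _≡_ _≡_ v →
  (∀ i → Adj G (v (inject₁ i)) (v (fsuc i)) ≡ true) → Adj G (v (fromℕ (2 + m))) (v fzero) ≡ true → Cycle (3 + m) G
Cycle-from-Fin {n} {m} G v v-inj adj closing = record
  { vertex = λ i → v (i mod M)
  ; adjacent = λ i → step (i mod M) (suc i mod M) (next i)
  ; periodic = λ i → cong v (toℕ-injective (begin
      toℕ ((M + i) mod M) ≡⟨ toℕ-mod (M + i) ⟩
      (M + i) % M         ≡⟨ cong (_% M) (+-comm M i) ⟩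
      (i + M) % M         ≡⟨ [m+n]%n≡m%n i M ⟩
      i % M               ≡⟨ toℕ-mod i ⟨
      toℕ (i mod M)       ∎))
  ; injective = λ i j j<M eq → shift i j j<M (begin
      i % M               ≡⟨ toℕ-mod i ⟨
      toℕ (i mod M)       ≡⟨ cong toℕ (v-inj eq) ⟩
      toℕ ((j + i) mod M) ≡⟨ toℕ-mod (j + i) ⟩
      (j + i) % M         ∎)
  }
  where
  open ≡-Reasoning
  M = 3 + m
  toℕ-mod : ∀ i → toℕ (i mod M) ≡ i % M
  toℕ-mod i = toℕ-fromℕ< (m%n<n i M)
  next : ∀ i → toℕ (suc i mod M) ≡ suc (toℕ (i mod M)) % M
  next i = begin
    toℕ (suc i mod M)         ≡⟨ toℕ-mod (suc i) ⟩
    suc i % M                 ≡⟨ %-distribˡ-+ 1 i M ⟩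
    suc (i % M) % M           ≡⟨ cong (λ r → suc r % M) (toℕ-mod i) ⟨
    suc (toℕ (i mod M)) % M   ∎
  step : ∀ a b → toℕ b ≡ suc (toℕ a) % M → Adj G (v a) (v b) ≡ true
  step a b eq with toℕ a <? 2 + m
  ... | yes a< = subst₂ (λ x y → Adj G (v x) (v y) ≡ true)
    (toℕ-injective (trans (toℕ-inject₁ _) (toℕ-fromℕ< a<)))
    (toℕ-injective (trans (cong suc (toℕ-fromℕ< a<)) (≡-sym (trans eq (m<n⇒m%n≡m (s≤s a<))))))
    (adj (fromℕ< a<))
  ... | no a≮ = subst₂ (λ x y → Adj G (v x) (v y) ≡ true)
    (toℕ-injective (trans (toℕ-fromℕ (2 + m)) (≡-sym a≡last)))
    (toℕ-injective (≡-sym (trans eq (trans (cong (λ r → suc r % M) a≡last) ([m+n]%n≡m%n 0 M)))))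
    closing
    where
    a≡last : toℕ a ≡ 2 + m
    a≡last = ≤-antisym (s≤s⁻¹ (toℕ<n a)) (≮⇒≥ a≮)
  reduced : ∀ i j → j < M → i % M ≡ (j + i) % M → i % M ≡ (j + i % M) % M
  reduced i j j<M eq = trans eq (trans (%-distribˡ-+ j i M) (cong (λ r → (r + i % M) % M) (m<n⇒m%n≡m j<M)))
  shift : ∀ i j → j < M → i % M ≡ (j + i) % M → j ≡ 0
  shift i j j<M eq with j + i % M <? M
  ... | yes small = +-cancelʳ-≡ (i % M) j 0 (trans (≡-sym (m<n⇒m%n≡m small)) (≡-sym (reduced i j j<M eq)))
  -- Here the sum wraps around once, so its remainder is j + i % M - M; equality with i % M would
  -- force j = M.
  ... | no large = contradiction j<M (<-irrefl (+-cancelʳ-≡ (i % M) j M (begin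
    j + i % M             ≡⟨ m+[n∸m]≡n (≮⇒≥ large) ⟨
    M + excess            ≡⟨ cong (M +_) (m<n⇒m%n≡m excess<M) ⟨
    M + excess % M        ≡⟨ cong (M +_) ([m+n]%n≡m%n excess M) ⟨
    M + (excess + M) % M  ≡⟨ cong (λ r → M + r % M) (trans (+-comm excess M) (m+[n∸m]≡n (≮⇒≥ large))) ⟩
    M + (j + i % M) % M   ≡⟨ cong (M +_) (reduced i j j<M eq) ⟨
    M + i % M             ∎)))
    where
    excess = j + i % M ∸ M
    excess<M : excess < M
    excess<M = +-cancelˡ-< M _ _ (≤-<-trans (≤-reflexive (m+[n∸m]≡n (≮⇒≥ large))) (+-mono-< j<M (m%n<n i M)))

-- A copy of a graph containing a (3 + m)-cycle would carry that cycle along.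
superlinear : ∀ {k} (H : Graph k) → HasCycle H → ∀ C → Σ ℕ λ N → ∀ n → N ≤ n →
  Σ (Graph n) λ G → Free H G × n * C ≤ edgeCount G
superlinear H (m , v , v-inj , adj , closing) C = lowBound m C * suc C , λ n n-large → H-free (grow m C n-large (n * C) ≤-refl)
  where
  H-free : ∀ {n} → Σ (Graph n) (λ G → Admissible m C G × n * C ≤ edgeCount G) → Σ (Graph n) λ G → Free H G × n * C ≤ edgeCount G
  H-free (G , (_ , acyclic) , many) = G
    , (λ (f , f-inj , copy) → acyclic (Cycle-from-Fin G (f ∘ v) (v-inj ∘ f-inj) (λ i → copy _ _ (adj i)) (copy _ _ closing)))
    , many

-- Ramsey arguments

AllPairs-map-∈ : ∀ {A : Set} {R S : A → A → Set} {xs : List A} →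
  (∀ {x y} → x ∈ xs → y ∈ xs → R x y → S x y) → AllPairs R xs → AllPairs S xs
AllPairs-map-∈ R⇒S [] = []
AllPairs-map-∈ R⇒S (px ∷ pxs) = All.tabulate (λ y∈ → R⇒S (here refl) (there y∈) (All.lookup px y∈))
  ∷ AllPairs-map-∈ (λ x∈ y∈ → R⇒S (there x∈) (there y∈)) pxs

+-≤-+⇒⊎ : ∀ {x y} a b → x + y ≤ a + b → x ≤ a ⊎ y ≤ b
+-≤-+⇒⊎ {x} {y} a b le with x ≤? a | y ≤? b
... | yes x≤a | _ = inj₁ x≤a
... | no _ | yes y≤b = inj₂ y≤b
... | no x≰a | no y≰b = contradiction le (<⇒≱ (+-mono-< (≰⇒> x≰a) (≰⇒> y≰b)))

IsClique : ∀ {n} → Colouring n → Bool → List (Fin n) → Set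
IsClique c b = AllPairs (λ x y → x ≢ y × col c x y ≡ b)

split-by-colour : ∀ {n} (c : Colouring n) x ys {s t} → s + t ≤ length ys →
  s ≤ length (filter (λ y → col c x y ≟ᵇ true) ys) ⊎ t ≤ length (filter (λ y → ¬? (col c x y ≟ᵇ true)) ys)
split-by-colour c x ys s+t≤ = +-≤-+⇒⊎ _ _
  (≤-trans s+t≤ (≤-reflexive (≡-sym (length-filter-split (λ y → col c x y ≟ᵇ true) ys))))

-- The Erdős-Szekeres recursion, with the pivot vertex counted separately and the value 0 once an
-- empty clique suffices.
ramseyBound : ℕ → ℕ → ℕ
ramseyBound zero t = 0
ramseyBound (suc s) zero = 0
ramseyBound (suc s) (suc t) = suc (ramseyBound s (suc t) + ramseyBound (suc s) t)

-- The first vertex `x` sees enough of the remaining ones in one colour; a clique of that colour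
-- found among them is extended by `x`, one of the other colour is already large enough.
ramsey : ∀ {n} (c : Colouring n) s t {xs} → Unique xs → ramseyBound s t ≤ length xs →
  (Σ (List (Fin n)) λ Q → Q ⊆ xs × s ≤ length Q × IsClique c true Q) ⊎
  (Σ (List (Fin n)) λ Q → Q ⊆ xs × t ≤ length Q × IsClique c false Q)
ramsey c zero t _ _ = inj₁ ([] , (λ ()) , z≤n , [])
ramsey c (suc s) zero _ _ = inj₂ ([] , (λ ()) , z≤n , [])
ramsey {n} c (suc s) (suc t) {x ∷ xs} (x∉ ∷ uniq) (s≤s large) with split-by-colour c x xs large
... | inj₁ large₁ with ramsey c s (suc t) (Unique.filter⁺ (λ y → col c x y ≟ᵇ true) uniq) large₁
...   | inj₂ (Q , Q⊆ , large , clique) = inj₂ (Q , there ∘ proj₁ ∘ ∈-filter⁻ _ ∘ Q⊆ , large , clique)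
...   | inj₁ (Q , Q⊆ , large , clique) = inj₁ (x ∷ Q
        , (λ { (here e) → here e ; (there z∈) → there (proj₁ (∈-filter⁻ _ (Q⊆ z∈))) })
        , s≤s large
        , All.tabulate (λ z∈ → let z∈xs , xz = ∈-filter⁻ _ {xs = xs} (Q⊆ z∈) in All.lookup x∉ z∈xs , xz) ∷ clique)
ramsey {n} c (suc s) (suc t) {x ∷ xs} (x∉ ∷ uniq) (s≤s large) | inj₂ large₂
  with ramsey c (suc s) t (Unique.filter⁺ (λ y → ¬? (col c x y ≟ᵇ true)) uniq) large₂
...   | inj₁ (Q , Q⊆ , large , clique) = inj₁ (Q , there ∘ proj₁ ∘ ∈-filter⁻ _ ∘ Q⊆ , large , clique)
...   | inj₂ (Q , Q⊆ , large , clique) = inj₂ (x ∷ Q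
        , (λ { (here e) → here e ; (there z∈) → there (proj₁ (∈-filter⁻ _ (Q⊆ z∈))) })
        , s≤s large
        , All.tabulate (λ z∈ → let z∈xs , xz = ∈-filter⁻ _ {xs = xs} (Q⊆ z∈) in All.lookup x∉ z∈xs , ¬-not xz) ∷ clique)

-- Equals 2^l (t + 1) - 1: each of the `l` vertices costs one entry for itself and then half of the
-- rest.
homogeneousBound : ℕ → ℕ → ℕ
homogeneousBound zero t = t
homogeneousBound (suc l) t = suc (homogeneousBound l t + homogeneousBound l t)

-- Distinctness is included because a colouring also has meaningless values on the diagonal.
Joined : ∀ {n} → Colouring n → Bool → Fin n → Fin n → Set
Joined c b x y = x ≢ y × col c x y ≡ b

-- Each `w` is deleted from the list, and a large enough colour class as seen from `w` is kept;
-- later choices only shrink the list, so homogeneity towards `w` persists.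
homogenise : ∀ {n} (c : Colouring n) t ws {xs} → Unique xs → homogeneousBound (length ws) t ≤ length xs →
  Σ (List (Fin n)) λ Q → Q ⊆ xs × Unique Q × t ≤ length Q ×
    (∀ {w} → w ∈ ws → Σ Bool λ b → ∀ {q} → q ∈ Q → Joined c b w q)
homogenise c t [] {xs} uniq large = xs , id , uniq , large , (λ ())
homogenise {n} c t (w ∷ ws) {xs} uniq large = by-colour (split-by-colour c w others (s≤s⁻¹ (≤-trans large others-large)))
  where
  others = filter (λ q → ¬? (w ≟ᶠ q)) xs
  others-Unique : Unique others
  others-Unique = Unique.filter⁺ _ uniq
  -- As `xs` has no repetition, at most one entry equals `w`.
  others-large : length xs ≤ suc (length others)
  others-large = ≤-trans (≤-reflexive (≡-sym (length-filter-split (w ≟ᶠ_) xs)))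
    (+-monoˡ-≤ _ (Unique-⊆-length {ys = w ∷ []} (Unique.filter⁺ (w ≟ᶠ_) uniq)
      (λ x∈ → here (≡-sym (proj₂ (∈-filter⁻ (w ≟ᶠ_) {xs = xs} x∈))))))
  others⁻ : ∀ {x} → x ∈ others → x ∈ xs × w ≢ x
  others⁻ = ∈-filter⁻ _
  Result = Σ (List (Fin n)) λ Q → Q ⊆ xs × Unique Q × t ≤ length Q ×
    (∀ {u} → u ∈ w ∷ ws → Σ Bool λ b → ∀ {q} → q ∈ Q → Joined c b u q)
  recurse : ∀ {ys} b → Unique ys → (∀ {y} → y ∈ ys → y ∈ others × col c w y ≡ b) →
    homogeneousBound (length ws) t ≤ length ys → Result
  recurse b ys-Unique ys⁻ ys-large with homogenise c t ws ys-Unique ys-large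
  ... | Q , Q⊆ , Q-Unique , t≤ , hom = Q , proj₁ ∘ others⁻ ∘ proj₁ ∘ ys⁻ ∘ Q⊆ , Q-Unique , t≤
      , λ { (here refl) → b , λ q∈ → proj₂ (others⁻ (proj₁ (ys⁻ (Q⊆ q∈)))) , proj₂ (ys⁻ (Q⊆ q∈))
          ; (there u∈) → hom u∈ }
  by-colour : _ ⊎ _ → Result
  by-colour (inj₁ large₁) = recurse true (Unique.filter⁺ _ others-Unique) (∈-filter⁻ _) large₁
  by-colour (inj₂ large₂) = recurse false (Unique.filter⁺ _ others-Unique)
    (λ y∈ → let y∈o , ≢true = ∈-filter⁻ _ {xs = others} y∈ in y∈o , ¬-not ≢true) large₂

-- Monochromatic copies of a bipartite graph

InMonoCopy-swap : ∀ {k n} (H : Graph k) (c : Colouring n) {x y} → InMonoCopy H c x y → InMonoCopy H c y x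
InMonoCopy-swap H c (b , f , f-inj , mono , i , j , ij , fi , fj) = b , f , f-inj , mono , j , i , trans (sym H j i) ij , fj , fi

-- Prescribing the images of vertices of H

override : ∀ {k} {A : Set} → Fin k → A → (Fin k → A) → Fin k → A
override i₀ x g i with i ≟ᶠ i₀
... | yes _ = x
... | no _  = g i

override-at : ∀ {k} {A : Set} (i₀ : Fin k) {x : A} {g} → override i₀ x g i₀ ≡ x
override-at i₀ with i₀ ≟ᶠ i₀
... | yes _ = refl
... | no ≢ = contradiction refl ≢

override-elim : ∀ {k} {A : Set} (P : Fin k → A → Set) {i₀ x g} → P i₀ x → (∀ i → P i (g i)) → ∀ i → P i (override i₀ x g i)
override-elim P {i₀} p q i with i ≟ᶠ i₀
... | yes refl = p
... | no _ = q i

override-injective : ∀ {k} {A : Set} {i₀ : Fin k} {x : A} {g} → (∀ i → x ≢ g i) → (∀ {i j} → g i ≡ g j → i ≡ j) →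
  ∀ {i j} → override i₀ x g i ≡ override i₀ x g j → i ≡ j
override-injective {i₀ = i₀} x∉g g-inj {i} {j} eq with i ≟ᶠ i₀ | j ≟ᶠ i₀
... | yes i≡ | yes j≡ = trans i≡ (≡-sym j≡)
... | yes _  | no _   = contradiction eq (x∉g j)
... | no _   | yes _  = contradiction (≡-sym eq) (x∉g i)
... | no _   | no _   = g-inj eq

-- The default `d` makes the function total; for an entry of `ts` it is never reached when `xs` is
-- at least as long as `ts`.
assign : ∀ {k} {A : Set} → List (Fin k) → List A → A → Fin k → A
assign (t ∷ ts) (x ∷ xs) d = override t x (assign ts xs d)
assign _ _ d _ = d

assign-∈ : ∀ {k} {A : Set} ts xs {d : A} → length ts ≤ length xs → ∀ {i : Fin k} → i ∈ ts → assign ts xs d i ∈ xs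
assign-∈ (t ∷ ts) (x ∷ xs) (s≤s le) {i} i∈ with i ≟ᶠ t | i∈
... | yes _ | _ = here refl
... | no i≢t | here i≡t = contradiction i≡t i≢t
... | no _ | there i∈ts = there (assign-∈ ts xs le i∈ts)

assign-injective : ∀ {k} {A : Set} ts {xs} {d : A} → Unique xs → length ts ≤ length xs →
  ∀ {i j : Fin k} → i ∈ ts → j ∈ ts → assign ts xs d i ≡ assign ts xs d j → i ≡ j
assign-injective (t ∷ ts) {x ∷ xs} (x∉ ∷ uniq) (s≤s le) {i} {j} i∈ j∈ eq with i ≟ᶠ t | j ≟ᶠ t | i∈ | j∈
... | yes i≡ | yes j≡ | _ | _ = trans i≡ (≡-sym j≡)
... | no i≢ | _ | here i≡ | _ = contradiction i≡ i≢
... | _ | no j≢ | _ | here j≡ = contradiction j≡ j≢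
... | yes _ | no _ | _ | there j∈ts = contradiction eq (All.lookup x∉ (assign-∈ ts xs le j∈ts))
... | no _ | yes _ | there i∈ts | _ = contradiction (≡-sym eq) (All.lookup x∉ (assign-∈ ts xs le i∈ts))
... | no _ | no _ | there i∈ts | there j∈ts = assign-injective ts uniq le i∈ts j∈ts eq

-- With distinguished entries at the heads of both lists, `assign` sends one to the other; this is
-- how a copy is made to use a given vertex.
headed : ∀ {n} {P : Fin n → Set} → Decidable P → Fin n → List (Fin n) → List (Fin n)
headed P? x₀ xs = x₀ ∷ filter (λ x → P? x ×-dec ¬? (x₀ ≟ᶠ x)) xs

∈-headed⁺ : ∀ {n} {P : Fin n → Set} (P? : Decidable P) x₀ {xs x} → x ∈ xs → P x → x ∈ headed P? x₀ xs
∈-headed⁺ P? x₀ {x = x} x∈ p with x₀ ≟ᶠ x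
... | yes x₀≡x = here (≡-sym x₀≡x)
... | no x₀≢x = there (∈-filter⁺ (λ x → P? x ×-dec ¬? (x₀ ≟ᶠ x)) x∈ (p , x₀≢x))

∈-headed⁻ : ∀ {n} {P : Fin n → Set} (P? : Decidable P) x₀ {xs x} → x ∈ headed P? x₀ xs → x ≡ x₀ ⊎ (x ∈ xs × P x)
∈-headed⁻ P? x₀ (here x≡x₀) = inj₁ x≡x₀
∈-headed⁻ P? x₀ {xs} (there x∈) with ∈-filter⁻ (λ x → P? x ×-dec ¬? (x₀ ≟ᶠ x)) {xs = xs} x∈
... | x∈xs , p , _ = inj₂ (x∈xs , p)

headed-Unique : ∀ {n} {P : Fin n → Set} (P? : Decidable P) x₀ {xs} → Unique xs → Unique (headed P? x₀ xs)
headed-Unique P? x₀ {xs} uniq = All.tabulate (λ x∈ → proj₂ (proj₂ (∈-filter⁻ (λ x → P? x ×-dec ¬? (x₀ ≟ᶠ x)) {xs = xs} x∈)))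
  ∷ Unique.filter⁺ _ uniq

side : ∀ {k} → (Fin k → Bool) → Bool → Fin k → List (Fin k)
side χ b i₀ = headed (λ i → χ i ≟ᵇ b) i₀ (allFin _)

∈-side⁺ : ∀ {k} (χ : Fin k → Bool) {b i₀ i} → χ i ≡ b → i ∈ side χ b i₀
∈-side⁺ χ {b} {i₀} {i} = ∈-headed⁺ (λ i → χ i ≟ᵇ b) i₀ (∈-allFin i)

∈-side⁻ : ∀ {k} (χ : Fin k → Bool) {b i₀ i} → χ i₀ ≡ b → i ∈ side χ b i₀ → χ i ≡ b
∈-side⁻ χ {b} {i₀} χi₀ i∈ with ∈-headed⁻ (λ i → χ i ≟ᵇ b) i₀ {xs = allFin _} i∈
... | inj₁ refl = χi₀
... | inj₂ (_ , χi) = χi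

side-Unique : ∀ {k} (χ : Fin k → Bool) {b i₀} → Unique (side χ b i₀)
side-Unique {k} χ {b} {i₀} = headed-Unique (λ i → χ i ≟ᵇ b) i₀ (Unique.allFin⁺ k)

sides-length : ∀ {k} (χ : Fin k → Bool) {i₀ j₀} → χ i₀ ≡ true → χ j₀ ≡ false →
  length (side χ true i₀) + length (side χ false j₀) ≤ k
sides-length χ {i₀} {j₀} χi₀ χj₀ = ≤-trans (≤-reflexive (≡-sym (length-++ (side χ true i₀))))
  (Unique-length≤n (Unique.++⁺ (side-Unique χ) (side-Unique χ) disjoint))
  where
  disjoint : ∀ {i} → i ∈ side χ true i₀ × i ∈ side χ false j₀ → ⊥
  disjoint (i∈ , i∈′) with trans (≡-sym (∈-side⁻ χ χi₀ i∈)) (∈-side⁻ χ χj₀ i∈′)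
  ... | ()

Joined-sym : ∀ {n} (c : Colouring n) {b x y} → Joined c b x y → Joined c b y x
Joined-sym c (x≢y , xy) = x≢y ∘ ≡-sym , trans (colSym c _ _) xy

length-≤-fibres : ∀ {A : Set} {n} (xs : List (Fin n)) (es : List (Fin n × A)) → (∀ {e} → e ∈ es → proj₁ e ∈ xs) →
  length es ≤ sum (map (λ x → length (filter (λ e → proj₁ e ≟ᶠ x) es)) xs)
length-≤-fibres xs [] _ = z≤n
length-≤-fibres xs (e ∷ es) covered = ≤-trans (s≤s (length-≤-fibres xs es (covered ∘ there)))
  (sum-map-mono-< grows (covered (here refl)) grows-strictly)
  where
  grows : ∀ x → length (filter (λ e → proj₁ e ≟ᶠ x) es) ≤ length (filter (λ e → proj₁ e ≟ᶠ x) (e ∷ es))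
  grows x with does (proj₁ e ≟ᶠ x)
  ... | true  = n≤1+n _
  ... | false = ≤-refl
  grows-strictly : length (filter (λ e′ → proj₁ e′ ≟ᶠ proj₁ e) es) < length (filter (λ e′ → proj₁ e′ ≟ᶠ proj₁ e) (e ∷ es))
  grows-strictly rewrite dec-true (proj₁ e ≟ᶠ proj₁ e) refl = ≤-refl

-- Bounding the NIM-edges of the opposite colour

module _ {k n} (H : Graph k) (c : Colouring n) (χ : Fin k → Bool) (bip : ∀ i j → Adj H i j ≡ true → χ i ≢ χ j)
  {i₀ j₀ : Fin k} (i₀j₀ : Adj H i₀ j₀ ≡ true) (χi₀ : χ i₀ ≡ true) (χj₀ : χ j₀ ≡ false) where

  private
    T U : List (Fin k)
    T = side χ true i₀
    U = side χ false j₀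

  -- The class of `i₀` is mapped by `L` and that of `j₀` by `R`; `Joined` keeps the two images
  -- disjoint, and the edge `i₀j₀` lands on the required pair.
  completeBipartite-copy : ∀ {b} (L R : Fin k → Fin n) →
    (∀ {i j} → χ i ≡ true → χ j ≡ true → L i ≡ L j → i ≡ j) →
    (∀ {i j} → χ i ≡ false → χ j ≡ false → R i ≡ R j → i ≡ j) →
    (∀ {i j} → χ i ≡ true → χ j ≡ false → Joined c b (L i) (R j)) →
    InMonoCopy H c (L i₀) (R j₀)
  completeBipartite-copy {b} L R L-inj R-inj joined =
    b , f , f-inj , mono , i₀ , j₀ , i₀j₀ , cong (λ z → if z then L i₀ else R i₀) χi₀ , cong (λ z → if z then L j₀ else R j₀) χj₀
    where
    f : Fin k → Fin n
    f i = if χ i then L i else R i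
    f-inj : Injective _≡_ _≡_ f
    f-inj {i} {j} eq with χ i in χi | χ j in χj
    ... | true  | true  = L-inj χi χj eq
    ... | true  | false = contradiction eq (proj₁ (joined χi χj))
    ... | false | true  = contradiction (≡-sym eq) (proj₁ (joined χj χi))
    ... | false | false = R-inj χi χj eq
    mono : ∀ i j → Adj H i j ≡ true → col c (f i) (f j) ≡ b
    mono i j ij with χ i in χi | χ j in χj
    ... | true  | true  = contradiction (trans χi (≡-sym χj)) (bip i j ij)
    ... | true  | false = proj₂ (joined χi χj)
    ... | false | true  = proj₂ (Joined-sym c (joined χj χi))
    ... | false | false = contradiction (trans χi (≡-sym χj)) (bip i j ij)

  -- The vertex `x` stands at `i₀` and clique vertices fill the rest of its class, so no colour
  -- between `x` and `q` is prescribed.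
  star-copy : ∀ {b x} (q R : Fin k → Fin n) → (∀ {i j} → q i ≡ q j → i ≡ j) → (∀ i → x ≢ q i) →
    (∀ {i j} → χ i ≡ false → χ j ≡ false → R i ≡ R j → i ≡ j) →
    (∀ {j} → χ j ≡ false → Joined c b x (R j)) →
    (∀ {i j} → χ i ≡ true → χ j ≡ false → Joined c b (q i) (R j)) →
    InMonoCopy H c x (R j₀)
  star-copy {b} {x} q R q-inj x∉q R-inj xR qR = subst (λ z → InMonoCopy H c z (R j₀)) (override-at i₀)
    (completeBipartite-copy (override i₀ x q) R (λ _ _ → override-injective x∉q q-inj) R-inj
      (λ {i} {j} χi χj → override-elim (λ i z → χ i ≡ true → Joined c b z (R j)) (λ _ → xR χj) (λ i χi → qR χi χj) i χi))

  -- A vertex v with many NIM-edges of colour b sees a clique q of the opposite colour; among the endpoints of E,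
  -- those joined to q in colour b cover E, are fewer than the class of i₀, and have few E-neighbours each.
  opposite-few : ∀ b v (N : List (Fin n)) (E : List (Fin n × Fin n)) →
    Unique N → (∀ {x} → x ∈ N → Joined c b v x × IsNIM H c v x) →
    Unique E → (∀ {x y} → (x , y) ∈ E → toℕ x < toℕ y × col c x y ≡ not b × IsNIM H c x y) →
    homogeneousBound (length E + length E) (ramseyBound k k) ≤ length N → length E ≤ k * k
  opposite-few b v N E N-Unique N⁻ E-Unique E⁻ N-large = conclude (homogenise c (ramseyBound k k) ws N-Unique N-large′)
    where
    ws : List (Fin n)
    ws = map proj₁ E ++ map proj₂ E
    ws-length : length ws ≡ length E + length E
    ws-length = trans (length-++ (map proj₁ E)) (cong₂ _+_ (length-map proj₁ E) (length-map proj₂ E))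
    N-large′ : homogeneousBound (length ws) (ramseyBound k k) ≤ length N
    N-large′ = subst (λ l → homogeneousBound l (ramseyBound k k) ≤ length N) (≡-sym ws-length) N-large

    module Count (q : Fin k → Fin n) (q-clique : ∀ i j → i ≢ j → Joined c (not b) (q i) (q j))
      (v-q : ∀ i → Joined c b v (q i)) (ws-q : ∀ {w} → w ∈ ws → Σ Bool λ b′ → ∀ i → Joined c b′ w (q i)) where

      q-inj : ∀ {i j} → q i ≡ q j → i ≡ j
      q-inj {i} {j} eq with i ≟ᶠ j
      ... | yes i≡j = i≡j
      ... | no i≢j = contradiction eq (proj₁ (q-clique i j i≢j))

      -- Endpoints in `ws` are homogeneous to `q`, so the colour towards the single vertex `q i₀`
      -- decides the colour towards all of `q`.
      Near : Fin n → Set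
      Near w = col c w (q i₀) ≡ b

      near? : ∀ w → Dec (Near w)
      near? w = col c w (q i₀) ≟ᵇ b

      near⇒joined : ∀ {w} → w ∈ ws → Near w → ∀ i → Joined c b w (q i)
      near⇒joined w∈ near i with ws-q w∈
      ... | b′ , joined = subst (λ z → Joined c z _ (q i)) (trans (≡-sym (proj₂ (joined i₀))) near) (joined i)

      far⇒joined : ∀ {w} → w ∈ ws → ¬ Near w → ∀ i → Joined c (not b) w (q i)
      far⇒joined w∈ far i with ws-q w∈
      ... | b′ , joined = subst (λ z → Joined c z _ (q i)) (trans (≡-sym (proj₂ (joined i₀))) (¬-not far)) (joined i)

      -- Placing `x` at `i₀`, `y` at `j₀` and clique vertices elsewhere uses only pairs of colour
      -- `not b`.
      far-far-copy : ∀ {x y} → x ∈ ws → y ∈ ws → ¬ Near x → ¬ Near y → Joined c (not b) x y → InMonoCopy H c x y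
      far-far-copy {x} {y} x∈ y∈ x-far y-far xy = subst (InMonoCopy H c x) (override-at j₀)
        (star-copy q (override j₀ y q) q-inj (proj₁ ∘ far⇒joined x∈ x-far)
          (λ _ _ → override-injective (proj₁ ∘ far⇒joined y∈ y-far) q-inj)
          (λ {j} _ → override-elim (λ _ z → Joined c (not b) x z) xy (far⇒joined x∈ x-far) j)
          (λ {i} {j} χi χj → override-elim (λ j z → χ j ≡ false → Joined c (not b) (q i) z)
            (λ _ → Joined-sym c (far⇒joined y∈ y-far i))
            (λ j χj → q-clique i j (λ { refl → contradiction (trans (≡-sym χi) χj) λ () })) j χj))

      orient : Fin n × Fin n → Fin n × Fin n
      orient (x , y) with near? x
      ... | yes _ = x , y
      ... | no _  = y , x

      E′ : List (Fin n × Fin n)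
      E′ = map orient E

      E-∈ws : ∀ {x y} → (x , y) ∈ E → x ∈ ws × y ∈ ws
      E-∈ws e∈ = ∈-++⁺ˡ (∈-map⁺ proj₁ e∈) , ∈-++⁺ʳ (map proj₁ E) (∈-map⁺ proj₂ e∈)

      E-joined : ∀ {x y} → (x , y) ∈ E → Joined c (not b) x y
      E-joined e∈ = (λ { refl → <-irrefl refl (proj₁ (E⁻ e∈)) }) , proj₁ (proj₂ (E⁻ e∈))

      Oriented : Fin n × Fin n → Set
      Oriented (x , y) = (x ∈ ws × y ∈ ws) × Near x × Joined c (not b) x y × IsNIM H c x y

      -- By `far-far-copy` a NIM-edge cannot have two far ends, so `orient` always finds a near one
      -- to put first.
      orient-Oriented : ∀ {e} → e ∈ E → Oriented (orient e)
      orient-Oriented {x , y} e∈ with near? x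
      ... | yes x-near = E-∈ws e∈ , x-near , E-joined e∈ , proj₂ (proj₂ (E⁻ e∈))
      ... | no x-far with near? y
      ...   | yes y-near = (proj₂ (E-∈ws e∈) , proj₁ (E-∈ws e∈)) , y-near , Joined-sym c (E-joined e∈)
                , proj₂ (proj₂ (E⁻ e∈)) ∘ InMonoCopy-swap H c
      ...   | no y-far = contradiction
                (far-far-copy (proj₁ (E-∈ws e∈)) (proj₂ (E-∈ws e∈)) x-far y-far (E-joined e∈)) (proj₂ (proj₂ (E⁻ e∈)))

      E′⁻ : ∀ {e} → e ∈ E′ → Oriented e
      E′⁻ e∈ with ∈-map⁻ orient e∈
      ... | _ , e′∈ , refl = orient-Oriented e′∈

      -- Pairs in `E` are increasing, so a swapped pair is decreasing and cannot coincide with an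
      -- unswapped one.
      orient-injective : ∀ {e e′} → e ∈ E → e′ ∈ E → orient e ≡ orient e′ → e ≡ e′
      orient-injective {x , y} {x′ , y′} e∈ e′∈ eq with near? x | near? x′
      ... | yes _ | yes _ = eq
      orient-injective e∈ e′∈ refl | yes _ | no _ = contradiction (proj₁ (E⁻ e∈)) (<-asym (proj₁ (E⁻ e′∈)))
      orient-injective e∈ e′∈ refl | no _ | yes _ = contradiction (proj₁ (E⁻ e∈)) (<-asym (proj₁ (E⁻ e′∈)))
      orient-injective e∈ e′∈ refl | no _ | no _ = refl

      E′-Unique : Unique E′
      E′-Unique = AllPairs.map⁺ (AllPairs-map-∈ (λ e∈ e′∈ e≢e′ → e≢e′ ∘ orient-injective e∈ e′∈) E-Unique)

      cover : List (Fin n)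
      cover = headed near? v (deduplicate _≟ᶠ_ ws)

      cover⁺ : ∀ {x} → x ∈ ws → Near x → x ∈ cover
      cover⁺ x∈ = ∈-headed⁺ near? v (∈-deduplicate⁺ _≟ᶠ_ x∈)

      cover-joined : ∀ {x} → x ∈ cover → ∀ i → Joined c b x (q i)
      cover-joined x∈ with ∈-headed⁻ near? v x∈
      ... | inj₁ refl = v-q
      ... | inj₂ (x∈ws , near) = near⇒joined (∈-deduplicate⁻ _≟ᶠ_ ws x∈ws) near

      cover-Unique : Unique cover
      cover-Unique = headed-Unique near? v (deduplicate-! _≟ᶠ_ ws)

      -- Otherwise `cover` and the clique span a copy of `H` in colour `b` with `v` at `i₀` and
      -- `q j₀` at `j₀`, through a NIM-edge. For this `v` heads `cover`.
      cover-small : IsNIM H c v (q j₀) → length cover < length T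
      cover-small nim with length T ≤? length cover
      ... | no T≰cover = ≰⇒> T≰cover
      ... | yes T≤cover = contradiction
        (subst (λ z → InMonoCopy H c z (q j₀)) (override-at i₀)
          (completeBipartite-copy L q
            (λ χi χj → assign-injective T cover-Unique T≤cover (∈-side⁺ χ χi) (∈-side⁺ χ χj))
            (λ _ _ → q-inj)
            (λ χi _ → cover-joined (assign-∈ T cover T≤cover (∈-side⁺ χ χi)) _)))
        nim
        where
        L = assign T cover v

      module Fibre (x : Fin n) where
        sources : List (Fin n × Fin n)
        sources = filter (λ e → proj₁ e ≟ᶠ x) E′

        targets far near : List (Fin n)
        targets = map proj₂ sources
        near = filter near? targets
        far = filter (¬? ∘ near?) targets

        targets⁻ : ∀ {y} → y ∈ targets → Oriented (x , y)
        targets⁻ y∈ with ∈-map⁻ proj₂ y∈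
        ... | (x′ , y) , e∈ , refl with ∈-filter⁻ (λ e → proj₁ e ≟ᶠ x) {xs = E′} e∈
        ... | e∈E′ , refl = E′⁻ e∈E′

        targets-Unique : Unique targets
        targets-Unique = AllPairs.map⁺ (AllPairs-map-∈ (λ e∈ e′∈ e≢e′ eq → e≢e′
            (cong₂ _,_ (trans (source≡x e∈) (≡-sym (source≡x e′∈))) eq)) (Unique.filter⁺ _ E′-Unique))
          where
          source≡x : ∀ {e} → e ∈ sources → proj₁ e ≡ x
          source≡x e∈ = proj₂ (∈-filter⁻ (λ e → proj₁ e ≟ᶠ x) {xs = E′} e∈)

        far⁻ : ∀ {y} → y ∈ far → Oriented (x , y) × (∀ i → Joined c (not b) y (q i))
        far⁻ y∈ with ∈-filter⁻ (¬? ∘ near?) {xs = targets} y∈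
        ... | y∈t , y-far = targets⁻ y∈t , far⇒joined (proj₂ (proj₁ (targets⁻ y∈t))) y-far

        -- Otherwise far targets fill the class of `j₀`, and `x` at `i₀` with clique vertices fills
        -- the other: a copy in colour `not b` through the NIM-edge from `x` to `R j₀`. The colour
        -- `b` between `x` and the clique does no harm, as they lie in the same class.
        far-small : length far ≤ length U
        far-small with length U ≤? length far
        ... | no U≰far = ≰⇒≥ U≰far
        ... | yes U≤far = ⊥-elim (proj₂ (proj₂ (proj₂ edge))
          (star-copy q R q-inj (proj₁ ∘ near⇒joined (proj₁ (proj₁ edge)) (proj₁ (proj₂ edge)))
            (λ χi χj → assign-injective U (Unique.filter⁺ _ targets-Unique) U≤far (∈-side⁺ χ χi) (∈-side⁺ χ χj))
            (λ χj → proj₁ (proj₂ (proj₂ (proj₁ (far⁻ (R∈ χj))))))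
            (λ {i} _ χj → Joined-sym c (proj₂ (far⁻ (R∈ χj)) i))))
          where
          R = assign U far v
          R∈ : ∀ {j} → χ j ≡ false → R j ∈ far
          R∈ χj = assign-∈ U far U≤far (∈-side⁺ χ χj)
          edge = proj₁ (far⁻ (R∈ χj₀))

        near-small : length near ≤ length cover
        near-small = Unique-⊆-length (Unique.filter⁺ near? targets-Unique)
          (λ y∈ → let y∈t , y-near = ∈-filter⁻ near? {xs = targets} y∈
                  in cover⁺ (proj₂ (proj₁ (targets⁻ y∈t))) y-near)

        -- Near targets lie in `cover`, far ones number at most `length U`, and the two classes of
        -- `H` together have at most `k` vertices.
        sources-small : length cover < length T → length sources ≤ k
        sources-small cover<T = begin
          length sources            ≡⟨ length-map proj₂ sources ⟨
          length targets            ≡⟨ length-filter-split near? targets ⟨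
          length near + length far  ≤⟨ +-mono-≤ (≤-trans near-small (<⇒≤ cover<T)) far-small ⟩
          length T + length U       ≤⟨ sides-length χ χi₀ χj₀ ⟩
          k                         ∎
          where open ≤-Reasoning

      E-small : IsNIM H c v (q j₀) → length E ≤ k * k
      E-small nim = begin
        length E                                              ≡⟨ length-map orient E ⟨
        length E′                                             ≤⟨ length-≤-fibres cover E′ covered ⟩
        sum (map (λ x → length (Fibre.sources x)) cover)      ≤⟨ sum-map-mono (λ x → Fibre.sources-small x (cover-small nim)) cover ⟩
        sum (map (λ _ → k) cover)                             ≡⟨ sum-map-const k cover ⟩
        length cover * k                                      ≤⟨ *-monoˡ-≤ k (Unique-length≤k) ⟩
        k * k                                                 ∎
        where
        open ≤-Reasoning
        Unique-length≤k : length cover ≤ k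
        Unique-length≤k = ≤-trans (<⇒≤ (cover-small nim)) (≤-trans (m≤m+n _ _) (sides-length χ χi₀ χj₀))
        covered : ∀ {e} → e ∈ E′ → proj₁ e ∈ cover
        covered e∈ = let (x∈ , _) , x-near , _ = E′⁻ e∈ in cover⁺ x∈ x-near

    conclude : _ → length E ≤ k * k
    conclude (Q₀ , Q₀⊆N , Q₀-Unique , Q₀-large , hom) = [ with-clique true , with-clique false ]′ (ramsey c k k Q₀-Unique Q₀-large)
      where
      with-clique : ∀ b′ → (Σ (List (Fin n)) λ Q → Q ⊆ Q₀ × k ≤ length Q × IsClique c b′ Q) → length E ≤ k * k
      with-clique b′ (Q , Q⊆Q₀ , k≤Q , clique) = by-colour (b′ ≟ᵇ b)
        where
        -- Indexing clique vertices by the vertices of `H` lets `q` serve directly as an embedding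
        -- of either class.
        q : Fin k → Fin n
        q i = lookup Q (inject≤ i k≤Q)
        q∈ : ∀ i → q i ∈ Q₀
        q∈ i = Q⊆Q₀ (∈-lookup _)
        q-clique : ∀ i j → i ≢ j → Joined c b′ (q i) (q j)
        q-clique i j i≢j = AllPairs-lookup (Joined-sym c) clique _ _ (i≢j ∘ inject≤-injective k≤Q k≤Q i j)
        v-q : ∀ i → Joined c b v (q i)
        v-q i = proj₁ (N⁻ (Q₀⊆N (q∈ i)))
        nim : IsNIM H c v (q j₀)
        nim = proj₂ (N⁻ (Q₀⊆N (q∈ j₀)))
        q-inj : ∀ {i j} → q i ≡ q j → i ≡ j
        q-inj eq = inject≤-injective k≤Q k≤Q _ _ (Unique⇒lookup-injective (AllPairs.map proj₁ clique) eq)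
        by-colour : Dec (b′ ≡ b) → length E ≤ k * k
        -- If the clique has colour `b`, adding `v` keeps it a clique of that colour, with a copy
        -- through the NIM-edge from `v` to `q j₀`.
        by-colour (yes refl) = contradiction
          (star-copy q q q-inj (proj₁ ∘ v-q) (λ _ _ → q-inj) (λ _ → v-q _)
            (λ {i} {j} χi χj → q-clique i j (λ { refl → contradiction (trans (≡-sym χi) χj) λ () }))) nim
        by-colour (no b′≢b) = Count.E-small q
          (λ i j i≢j → subst (λ z → Joined c z (q i) (q j)) (¬-not b′≢b) (q-clique i j i≢j))
          v-q (λ w∈ → proj₁ (hom w∈) , λ i → proj₂ (hom w∈) (q∈ i)) nim


-- Splitting the NIM-edges by colour

does≡true⇒ : ∀ {P : Set} (p? : Dec P) → does p? ≡ true → P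
does≡true⇒ (yes p) _ = p

colourClass : ∀ {n} → Colouring n → Graph n → Bool → Graph n
Adj (colourClass c S b) i j = Adj S i j ∧ does (col c i j ≟ᵇ b)
sym (colourClass c S b) i j = cong₂ (λ a x → a ∧ does (x ≟ᵇ b)) (sym S i j) (colSym c i j)
irrefl (colourClass c S b) i rewrite irrefl S i = refl

colourClass⁻ : ∀ {n} (c : Colouring n) (S : Graph n) {b i j} → Adj (colourClass c S b) i j ≡ true →
  Adj S i j ≡ true × col c i j ≡ b
colourClass⁻ c S {b} {i} {j} ij = ∧-trueˡ ij , does≡true⇒ (col c i j ≟ᵇ b) (∧-trueʳ {Adj S i j} ij)

edgeCount-colourClass : ∀ {n} (c : Colouring n) (S : Graph n) →
  edgeCount S ≤ edgeCount (colourClass c S true) + edgeCount (colourClass c S false)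
edgeCount-colourClass {n} c S = begin
  edgeCount S                                             ≤⟨ sum-map-mono (λ i → sum-map-mono (entry i) V) V ⟩
  sum (map (λ i → sum (map (λ j → up true i j + up false i j) V)) V)
    ≤⟨ sum-map-mono (λ i → ≤-reflexive (sum-map-+ (up true i) (up false i) V)) V ⟩
  sum (map (λ i → sum (map (up true i) V) + sum (map (up false i) V)) V)
    ≡⟨ sum-map-+ (λ i → sum (map (up true i) V)) (λ i → sum (map (up false i) V)) V ⟩
  edgeCount (colourClass c S true) + edgeCount (colourClass c S false) ∎
  where
  open ≤-Reasoning
  V = allFin n
  up : Bool → Fin n → Fin n → ℕ
  up b i j = indicator ((toℕ i <ᵇ toℕ j) ∧ Adj (colourClass c S b) i j)
  split : ∀ l a x → indicator (l ∧ a) ≤ indicator (l ∧ (a ∧ does (x ≟ᵇ true))) + indicator (l ∧ (a ∧ does (x ≟ᵇ false)))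
  split false _ _ = z≤n
  split true false _ = z≤n
  split true true true = ≤-refl
  split true true false = ≤-refl
  entry : ∀ i j → indicator ((toℕ i <ᵇ toℕ j) ∧ Adj S i j) ≤ up true i j + up false i j
  entry i j = split (toℕ i <ᵇ toℕ j) (Adj S i j) (col c i j)

-- The neighbourhood size demanded by `opposite-few` for `suc (k * k)` edges, whose endpoints are
-- listed twice as many times.
degreeBound : ℕ → ℕ
degreeBound k = homogeneousBound (suc (k * k) + suc (k * k)) (ramseyBound k k)

module _ {k n} (H : Graph k) (c : Colouring n) (S : Graph n) (nim : ∀ u v → Adj S u v ≡ true → IsNIM H c u v)
  {i₀ j₀ : Fin k} (i₀j₀ : Adj H i₀ j₀ ≡ true) where

  -- A copy of `H` in the class is monochromatic, yet the image of `i₀j₀` in it is a NIM-edge.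
  colourClass-free : ∀ b → Free H (colourClass c S b)
  colourClass-free b (f , f-inj , copy) = nim (f i₀) (f j₀) (proj₁ (colourClass⁻ c S (copy i₀ j₀ i₀j₀)))
    (b , f , f-inj , (λ i j ij → proj₂ (colourClass⁻ c S (copy i j ij))) , i₀ , j₀ , i₀j₀ , refl , refl)

  -- Only `suc (k * k)` edges are handed to `opposite-few`, so that the degree required of `v`
  -- depends on `k` alone; one edge above `k * k` already gives the contradiction.
  opposite-edgeCount : ∀ (χ : Fin k → Bool) → (∀ i j → Adj H i j ≡ true → χ i ≢ χ j) → χ i₀ ≡ true → χ j₀ ≡ false →
    ∀ b v → degreeBound k ≤ degree (colourClass c S b) v → edgeCount (colourClass c S (not b)) ≤ k * k
  opposite-edgeCount χ bip χi₀ χj₀ b v large with edgeCount (colourClass c S (not b)) ≤? k * k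
  ... | yes few = few
  ... | no many = contradiction
    (opposite-few H c χ bip i₀j₀ χi₀ χj₀ b v (nbrs Sᵇ v) E (nbrs-Unique Sᵇ v) nbrs⁻
      (Unique.take⁺ (suc (k * k)) (edges-Unique S′)) (E⁻ ∘ ∈-edges⁻ S′ ∘ ∈-take (suc (k * k)) (edges S′))
      (≤-trans (≤-reflexive (cong (λ l → homogeneousBound (l + l) (ramseyBound k k)) E-length)) large))
    (<⇒≱ (≤-reflexive (≡-sym E-length)))
    where
    Sᵇ S′ : Graph n
    Sᵇ = colourClass c S b
    S′ = colourClass c S (not b)
    E : List (Fin n × Fin n)
    E = take (suc (k * k)) (edges S′)
    ∈-take : ∀ {A : Set} m (xs : List A) {x} → x ∈ take m xs → x ∈ xs
    ∈-take (suc m) (_ ∷ xs) (here x≡) = here x≡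
    ∈-take (suc m) (_ ∷ xs) (there x∈) = there (∈-take m xs x∈)
    E-length : length E ≡ suc (k * k)
    E-length = trans (length-take (suc (k * k)) (edges S′))
      (m≤n⇒m⊓n≡m (≤-trans (≰⇒> many) (≤-reflexive (≡-sym (length-edges S′)))))
    E⁻ : ∀ {x y} → toℕ x < toℕ y × Adj S′ x y ≡ true → toℕ x < toℕ y × col c x y ≡ not b × IsNIM H c x y
    E⁻ (x<y , xy) = x<y , proj₂ (colourClass⁻ c S xy) , nim _ _ (proj₁ (colourClass⁻ c S xy))
    nbrs⁻ : ∀ {x} → x ∈ nbrs Sᵇ v → Joined c b v x × IsNIM H c v x
    nbrs⁻ x∈ = let vx , colour = colourClass⁻ c S (∈-nbrs⁻ Sᵇ x∈) in (Adj⇒≢ S vx , colour) , nim _ _ vx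

bipartite-edge : ∀ {k} (H : Graph k) → HasCycle H → ∀ (χ : Fin k → Bool) → (∀ i j → Adj H i j ≡ true → χ i ≢ χ j) →
  Σ (Fin k) λ i → Σ (Fin k) λ j → Adj H i j ≡ true × χ i ≡ true × χ j ≡ false
bipartite-edge H (_ , v , _ , adj , _) χ bip = orient (adj fzero)
  where
  orient : ∀ {i j} → Adj H i j ≡ true → Σ _ λ i → Σ _ λ j → Adj H i j ≡ true × χ i ≡ true × χ j ≡ false
  orient {i} {j} ij with χ i in χi | χ j in χj
  ... | true  | true  = contradiction (trans χi (≡-sym χj)) (bip i j ij)
  ... | true  | false = i , j , ij , χi , χj
  ... | false | true  = j , i , trans (sym H j i) ij , χj , χi
  ... | false | false = contradiction (trans χi (≡-sym χj)) (bip i j ij)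

theorem1p12 : ∀ (h k : ℕ) (H : Graph k) → k ≤ h → Bipartite H → HasCycle H →
    Σ ℕ λ N → ∀ (n : ℕ) → N ≤ n → ∀ (e : ℕ) → IsEx n H e → NimAtMost n H (e + h * h)
-- The slope is twice `degreeBound k` because two colour classes of bounded degree have to be
-- outweighed together.
theorem1p12 h k H k≤h (χ , bip) cyc with superlinear H cyc (degreeBound k + degreeBound k) | bipartite-edge H cyc χ bip
... | N , dense-free | i₀ , j₀ , i₀j₀ , χi₀ , χj₀ = N , bound
  where
  bound : ∀ n → N ≤ n → ∀ e → IsEx n H e → NimAtMost n H (e + h * h)
  bound n N≤n e (_ , maximal) c S nim = by-degree (high? true) (high? false)
    where
    open ≤-Reasoning
    D = degreeBound k
    Sᶜ : Bool → Graph n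
    Sᶜ = colourClass c S
    High : Bool → Set
    High b = Σ (Fin n) λ v → D ≤ degree (Sᶜ b) v
    high? : ∀ b → Dec (High b)
    high? b = any? (λ v → D ≤? degree (Sᶜ b) v)
    Sᶜ≤e : ∀ b → edgeCount (Sᶜ b) ≤ e
    Sᶜ≤e b = maximal (Sᶜ b) (colourClass-free H c S nim i₀j₀ b)
    opposite≤h² : ∀ b → High b → edgeCount (Sᶜ (not b)) ≤ h * h
    opposite≤h² b (v , high) = ≤-trans (opposite-edgeCount H c S nim i₀j₀ χ bip χi₀ χj₀ b v high) (*-mono-≤ k≤h k≤h)
    low-edgeCount : ∀ b → ¬ High b → edgeCount (Sᶜ b) ≤ n * D
    low-edgeCount b none = edgeCount-≤-degree (Sᶜ b) (λ v → <⇒≤ (≰⇒> (λ high → none (v , high))))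
    by-degree : Dec (High true) → Dec (High false) → edgeCount S ≤ e + h * h
    -- A vertex of high degree in one colour makes the other class small, while its own class is
    -- `H`-free and bounded by `e`.
    by-degree (yes high) _ = ≤-trans (edgeCount-colourClass c S) (+-mono-≤ (Sᶜ≤e true) (opposite≤h² true high))
    by-degree (no _) (yes high) = begin
      edgeCount S                                     ≤⟨ edgeCount-colourClass c S ⟩
      edgeCount (Sᶜ true) + edgeCount (Sᶜ false)      ≤⟨ +-mono-≤ (opposite≤h² false high) (Sᶜ≤e false) ⟩
      h * h + e                                       ≡⟨ +-comm (h * h) e ⟩
      e + h * h                                       ∎
    by-degree (no low₁) (no low₂) with dense-free n N≤n
    ... | G , G-free , G-dense = begin
      edgeCount S                                     ≤⟨ edgeCount-colourClass c S ⟩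
      edgeCount (Sᶜ true) + edgeCount (Sᶜ false)      ≤⟨ +-mono-≤ (low-edgeCount true low₁) (low-edgeCount false low₂) ⟩
      n * D + n * D                                   ≡⟨ *-distribˡ-+ n D D ⟨
      n * (D + D)                                     ≤⟨ G-dense ⟩
      edgeCount G                                     ≤⟨ maximal G G-free ⟩
      e                                               ≤⟨ m≤m+n e (h * h) ⟩
      e + h * h                                       ∎
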